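{- Let $U=(0,0)$, $A=(18,24)$, $V=(50,0)$, $B=(32,-24)$. Then the set of rational points $P$ on the open segment $UV$ such that the Euclidean distances $PU,PV,PA,PB$ are all rational is exactly $\{(25,0)\}$. Equivalently, the only rational point strictly between $U$ and $V$ whose distances from all four points $U,A,V,B$ are rational is the midpoint $(25,0)$.
   Context: A rational point is a point with both coordinates in $\mathbb{Q}$. -}

module Defs where

open import Data.Integer.Base as ℤ using (+_)
open import Data.Product.Base using (_×_; _,_; ∃-syntax)
open import Data.Rational.Base
open import Level using (0ℓ)
open import Relation.Binary.PropositionalEquality using (_≡_)
open import Relation.Unary using (Pred)

RationalPoint : Set
RationalPoint = ℚ × ℚ

-- r is the nonnegative square root of the squared distance, so at most one
-- rational r satisfies this, and one exists iff the real distance is rational.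
IsEuclideanDistance : RationalPoint → RationalPoint → ℚ → Set
IsEuclideanDistance (x₁ , y₁) (x₂ , y₂) r =
  0ℚ ≤ r × r * r ≡ (x₁ - x₂) * (x₁ - x₂) + (y₁ - y₂) * (y₁ - y₂)

RationalDistance : RationalPoint → RationalPoint → Set
RationalDistance P Q = ∃[ r ] IsEuclideanDistance P Q r

-- The rational points of the open segment from S to T.  Restricting the
-- parameter t to ℚ loses nothing when S ≢ T: some coordinate of T - S is then
-- a nonzero rational, and t is a quotient of rationals.
OpenSegment : RationalPoint → RationalPoint → Pred RationalPoint 0ℓ
OpenSegment (x₁ , y₁) (x₂ , y₂) P =
  ∃[ t ] (0ℚ < t × t < 1ℚ ×
          P ≡ ((1ℚ - t) * x₁ + t * x₂ , (1ℚ - t) * y₁ + t * y₂))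

U A V B : RationalPoint
U = (+ 0 / 1) , (+ 0 / 1)
A = (+ 18 / 1) , (+ 24 / 1)
V = (+ 50 / 1) , (+ 0 / 1)
B = (+ 32 / 1) , (ℤ.- (+ 24) / 1)

midpointUV : RationalPoint
midpointUV = (+ 25 / 1) , (+ 0 / 1)

{-# OPTIONS --safe #-}

-- Let a / (a + b), in lowest terms, be the parameter of P on the segment.  Then PA and PB
-- are rational iff 16 a² + 9 b² and 9 a² + 16 b² are squares.  If a ≠ b, this yields an odd
-- W and a Y ≥ 1 for which W² + 625 Y² = X² and W² + 576 Y² = Z², and these do not exist by
-- infinite descent on Y, a pair of 2-isogeny descents on y² = x (x + 576) (x + 625).
-- Write (X + Z) / Y = r / t in lowest terms: (r² − t²) (r² − 2401 t²) is the square
-- of a rational, and since W is odd the gcd of the factors divides 75, so that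
-- r² − t² = d p² and r² − 2401 t² = d q² with d ∈ {1, 3, 5, 15}.  For u the odd one among
-- (p ± q) / 2, the product (d u² + 625 t²) (d u² + 576 t²) is d u² r².  Congruences modulo
-- 3, 4 and 5 leave only d = 1 with both factors squares up to a common square factor, and
-- u / t in lowest terms is the smaller solution.
module Submission where

open import Defs
open import Data.Empty using (⊥; ⊥-elim)
open import Data.Fin.Base using (Fin; toℕ; fromℕ<)
open import Data.Fin.Properties using (all?; toℕ-fromℕ<)
open import Data.Integer.Base as ℤ using (+_; -[1+_])
import Data.Integer.Properties as ℤ
open import Data.Nat.Base
open import Data.Nat.Coprimality using (Coprime; coprime?; coprime-divisor; coprime⇒gcd≡1)
open import Data.Nat.Divisibility
open import Data.Nat.DivMod using (_%_; _/_; m≡m%n+[m/n]*n; m%n<n; [m+kn]%n≡m%n)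
open import Data.Nat.GCD using (gcd; gcd[m,n]∣m; gcd[m,n]∣n; gcd-greatest; c*gcd[m,n]≡gcd[cm,cn]; gcd[m,n]≡0⇒n≡0)
open import Data.Nat.Induction using (<-rec)
open import Data.Nat.Primality using (Prime; prime?; prime⇒irreducible; euclidsLemma)
open import Data.Nat.Properties
open import Data.Nat.Tactic.RingSolver using (solve-∀)
open import Data.Product.Base using (_×_; _,_; ∃; ∃₂; proj₁; proj₂)
open import Data.Rational.Base as ℚ using (ℚ; mkℚ; 0ℚ; 1ℚ; ½; toℚᵘ)
import Data.Rational.Properties as ℚ
open import Data.Rational.Solver using (module +-*-Solver)
open import Data.Rational.Unnormalised.Base as ℚᵘ using (mkℚᵘ; *≡*)
import Data.Rational.Unnormalised.Properties as ℚᵘ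
open import Data.Sum.Base using (_⊎_; inj₁; inj₂; [_,_]′; reduce)
open import Function.Base using (_∘_)
open import Relation.Binary.PropositionalEquality
open import Relation.Nullary.Decidable using (Dec; yes; no; True; recompute; toWitness; toWitnessFalse; _→-dec_; _×-dec_; _⊎-dec_)
open import Relation.Nullary.Negation using (¬_; contradiction)
open import Relation.Unary using (_≐_; ｛_｝)

-- Coprimality and squares of natural numbers.

square-cancel-≤ : ∀ {m n} → m * m ≤ n * n → m ≤ n
square-cancel-≤ mm≤nn = ≮⇒≥ λ n<m → <⇒≱ (*-mono-< n<m n<m) mm≤nn

coprime-*ˡ : ∀ {a b c} → Coprime a c → Coprime b c → Coprime (a * b) c
coprime-*ˡ a⊥c b⊥c (d∣ab , d∣c) =
  b⊥c (coprime-divisor (λ { (e∣d , e∣a) → a⊥c (e∣a , ∣-trans e∣d d∣c) }) d∣ab , d∣c)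

coprime-square : ∀ {a b} → Coprime a b → Coprime (a * a) (b * b)
coprime-square a⊥b = flip (coprime-*ˡ b⊥aa b⊥aa)
  where
  flip : ∀ {m n} → Coprime m n → Coprime n m
  flip m⊥n (d∣n , d∣m) = m⊥n (d∣m , d∣n)
  b⊥aa = flip (coprime-*ˡ a⊥b a⊥b)

reduce-fraction : ∀ m n .{{_ : NonZero n}} → NonZero (gcd m n) ×
  ∃₂ λ a b → m ≡ gcd m n * a × n ≡ gcd m n * b × Coprime a b
reduce-fraction m n = nz , quotient g∣m , quotient g∣n , m≡ , n≡ , a⊥b
  where
  g = gcd m n
  g∣m = gcd[m,n]∣m m n
  g∣n = gcd[m,n]∣n m n
  m≡ = m∣n⇒n≡m*quotient g∣m
  n≡ = m∣n⇒n≡m*quotient g∣n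
  nz : NonZero g
  nz = ≢-nonZero (≢-nonZero⁻¹ n ∘ gcd[m,n]≡0⇒n≡0 m)
  a⊥b : Coprime (quotient g∣m) (quotient g∣n)
  a⊥b {d} (d∣a , d∣b) = ∣1⇒≡1 (*-cancelˡ-∣ g {{nz}} (subst (g * d ∣_) (sym (*-identityʳ g))
    (gcd-greatest (subst (g * d ∣_) (sym m≡) (*-monoʳ-∣ g d∣a))
                  (subst (g * d ∣_) (sym n≡) (*-monoʳ-∣ g d∣b)))))

-- Write n / m as b / a in lowest terms. Cancelling the square of the gcd leaves a² ∣ b², so a ∣ b,
-- and coprimality forces a = 1.
square-∣ : ∀ m n .{{_ : NonZero m}} → m * m ∣ n * n → m ∣ n
square-∣ m n mm∣nn with reduce-fraction n m
... | nz , b , a , n≡ , m≡ , b⊥a = divides b (trans n≡ (trans (cong (_* b) (sym m≡g)) (*-comm m b)))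
  where
  g = gcd n m
  instance _ = nz
  instance _ = m*n≢0 g g
  arrange : ∀ g x → g * x * (g * x) ≡ g * g * (x * x)
  arrange = solve-∀
  aa∣bb : a * a ∣ b * b
  aa∣bb = *-cancelˡ-∣ (g * g) (subst₂ _∣_
    (trans (cong (λ x → x * x) m≡) (arrange g a)) (trans (cong (λ x → x * x) n≡) (arrange g b)) mm∣nn)
  a∣b : a ∣ b
  a∣b = coprime-divisor (λ { (d∣a , d∣b) → b⊥a (d∣b , d∣a) }) (m*n∣⇒m∣ a a aa∣bb)
  m≡g : m ≡ g
  m≡g = trans m≡ (trans (cong (g *_) (b⊥a (a∣b , ∣-refl))) (*-identityʳ g))

-- With g = gcd c a, c = g y and a = g x, the equation becomes x b = y² g. Then x, coprime to y,
-- divides g; and g, a divisor of a and so coprime to b, divides x. Hence a = g².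
coprime-factor-of-square : ∀ a {b c} .{{_ : NonZero a}} → Coprime a b → a * b ≡ c * c →
  ∃ λ p → a ≡ p * p
coprime-factor-of-square a {b} {c} a⊥b ab≡cc with reduce-fraction c a
... | nz , y , x , c≡ , a≡ , y⊥x = g , trans a≡ (cong (g *_) (∣-antisym x∣g g∣x))
  where
  g = gcd c a
  instance _ = nz
  xb≡ : x * b ≡ y * (y * g)
  xb≡ = *-cancelˡ-≡ _ _ g (trans (sym (*-assoc g x b)) (trans (cong (_* b) (sym a≡))
          (trans ab≡cc (trans (cong (λ z → z * z) c≡) (arrange g y)))))
    where
    arrange : ∀ g y → g * y * (g * y) ≡ g * (y * (y * g))
    arrange = solve-∀
  x⊥y : Coprime x y
  x⊥y (d∣x , d∣y) = y⊥x (d∣y , d∣x)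
  x∣g : x ∣ g
  x∣g = coprime-divisor x⊥y (coprime-divisor x⊥y (subst (x ∣_) xb≡ (m∣m*n b)))
  g∣x : g ∣ x
  g∣x = coprime-divisor
    (λ { (d∣g , d∣b) → a⊥b (∣-trans d∣g (gcd[m,n]∣n c a) , d∣b) })
    (subst (g ∣_) (trans (sym xb≡) (*-comm x b)) (∣n⇒∣m*n y (∣n⇒∣m*n y ∣-refl)))

-- Dividing a and b by their gcd, and c² by its square, leaves coprime cofactors whose product is a
-- square, so each is a square.
square-class : ∀ a b {c} {{_ : NonZero a}} {{_ : NonZero b}} → a * b ≡ c * c →
  ∃₂ λ p q → a ≡ gcd a b * (p * p) × b ≡ gcd a b * (q * q)
square-class a b {c} {{a≢0}} {{b≢0}} ab≡cc with reduce-fraction a b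
... | nz , x , y , a≡ , b≡ , x⊥y = extract (gcd a b) {{nz}} a≡ b≡ x⊥y
  where
  -- A variable `g` in place of `gcd a b` lets both equations be matched with `refl`; with the gcd
  -- itself they would be cyclic.
  extract : ∀ g {{_ : NonZero g}} {x y} → a ≡ g * x → b ≡ g * y → Coprime x y →
    ∃₂ λ p q → a ≡ g * (p * p) × b ≡ g * (q * q)
  extract g {{nz}} {x} {y} refl refl x⊥y =
    let divides z c≡ = square-∣ g c (subst {A = ℕ} (g * g ∣_) ab≡cc (*-pres-∣ (m∣m*n {g} x) (m∣m*n {g} y)))
        xy≡zz = *-cancelˡ-≡ (x * y) (z * z) (g * g) {{m*n≢0 g g}} (trans (arrange₁ g x y)
                  (trans ab≡cc (trans (cong (λ w → w * w) c≡) (arrange₂ g z))))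
        p , x≡pp = coprime-factor-of-square x {y} {z} {{m*n≢0⇒n≢0 g {x} {{a≢0}}}} x⊥y xy≡zz
        q , y≡qq = coprime-factor-of-square y {x} {z} {{m*n≢0⇒n≢0 g {y} {{b≢0}}}}
                     (λ { (d∣y , d∣x) → x⊥y (d∣x , d∣y) }) (trans (*-comm y x) xy≡zz)
    in p , q , cong (g *_) x≡pp , cong (g *_) y≡qq
    where
    arrange₁ : ∀ g x y → g * g * (x * y) ≡ g * x * (g * y)
    arrange₁ = solve-∀
    arrange₂ : ∀ g z → z * g * (z * g) ≡ g * g * (z * z)
    arrange₂ = solve-∀

-- Multiplication by f commutes with the gcd, so f cancels from the result of `square-class`. In the
-- descent only the scaled product is known to be a square in ℕ.
square-class-scaled : ∀ f a b {c} {{_ : NonZero f}} {{_ : NonZero a}} {{_ : NonZero b}} →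
  f * a * (f * b) ≡ c * c → ∃₂ λ p q → a ≡ gcd a b * (p * p) × b ≡ gcd a b * (q * q)
square-class-scaled f a b {c} eq with square-class (f * a) (f * b) {c} {{m*n≢0 f a}} {{m*n≢0 f b}} eq
... | p , q , fa≡ , fb≡ = p , q , descale a p fa≡ , descale b q fb≡
  where
  descale : ∀ x s → f * x ≡ gcd (f * a) (f * b) * (s * s) → x ≡ gcd a b * (s * s)
  descale x s fx≡ = *-cancelˡ-≡ _ _ f (trans fx≡ (trans
    (cong (_* (s * s)) (sym (c*gcd[m,n]≡gcd[cm,cn] f a b))) (*-assoc f (gcd a b) (s * s))))

-- Parity.

2-prime : Prime 2
2-prime = toWitness {a? = prime? 2} _

2∣square⇒2∣ : ∀ n → 2 ∣ n * n → 2 ∣ n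
2∣square⇒2∣ n = reduce ∘ euclidsLemma n n 2-prime

odd⇒≢0 : ∀ {n} → 2 ∤ n → NonZero n
odd⇒≢0 {zero}  odd = contradiction (2 ∣0) odd
odd⇒≢0 {suc _} _   = _

odd⇒1+2k : ∀ n → 2 ∤ n → ∃ λ k → n ≡ 1 + 2 * k
odd⇒1+2k zero odd = contradiction (2 ∣0) odd
odd⇒1+2k (suc n) odd with 2 ∣? n
... | yes (divides k n≡) = k , cong suc (trans n≡ (*-comm k 2))
... | no odd′ with odd⇒1+2k n odd′
...   | k , n≡ = contradiction (divides (suc k) (trans (cong suc n≡) (arrange k))) odd
  where
  arrange : ∀ k → 2 + 2 * k ≡ suc k * 2
  arrange = solve-∀

odd∸odd : ∀ {m n} → 2 ∤ m → 2 ∤ n → n ≤ m → 2 ∣ m ∸ n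
odd∸odd {m} {n} m-odd n-odd n≤m =
  let i , m≡ = odd⇒1+2k m m-odd
      j , n≡ = odd⇒1+2k n n-odd
      eq : 2 * j + (m ∸ n) ≡ 2 * i
      eq = suc-injective (trans (cong (_+ (m ∸ n)) (sym n≡)) (trans (m+[n∸m]≡n n≤m) m≡))
  in ∣m+n∣m⇒∣n (subst (2 ∣_) (sym eq) (m∣m*n i)) (m∣m*n j)

odd-square : ∀ n → 2 ∤ n → ∃ λ k → n * n ≡ 1 + 8 * k
odd-square n n-odd with odd⇒1+2k n n-odd
... | i , n≡ with 2 ∣? i
...   | yes (divides j i≡) = j * (1 + 2 * j) , trans (cong (λ x → x * x) (trans n≡ (cong (λ x → 1 + 2 * x) i≡))) (arrange j)
  where
  arrange : ∀ j → (1 + 2 * (j * 2)) * (1 + 2 * (j * 2)) ≡ 1 + 8 * (j * (1 + 2 * j))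
  arrange = solve-∀
...   | no i-odd with odd⇒1+2k i i-odd
...     | j , i≡ = (1 + j) * (1 + 2 * j) , trans (cong (λ x → x * x) (trans n≡ (cong (λ x → 1 + 2 * x) i≡))) (arrange j)
  where
  arrange : ∀ j → (1 + 2 * (1 + 2 * j)) * (1 + 2 * (1 + 2 * j)) ≡ 1 + 8 * ((1 + j) * (1 + 2 * j))
  arrange = solve-∀

odd-* : ∀ {m n} → 2 ∤ m → 2 ∤ n → 2 ∤ m * n
odd-* {m} {n} m-odd n-odd = [ m-odd , n-odd ]′ ∘ euclidsLemma m n 2-prime

-- Diagonal binary quadratic forms modulo n.

form : (c₁ c₂ x y : ℕ) → ℕ
form c₁ c₂ x y = c₁ * (x * x) + c₂ * (y * y)

form-% : ∀ n .{{_ : NonZero n}} c₁ c₂ x y → form c₁ c₂ x y % n ≡ form c₁ c₂ (x % n) (y % n) % n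
form-% n c₁ c₂ x y = trans
  (cong₂ (λ s t → form c₁ c₂ s t % n) (m≡m%n+[m/n]*n x n) (m≡m%n+[m/n]*n y n))
  (trans (cong (_% n) (expand c₁ c₂ (x % n) (x / n) (y % n) (y / n) n)) ([m+kn]%n≡m%n (form c₁ c₂ (x % n) (y % n))
    (c₁ * (2 * (x % n * (x / n)) + x / n * (x / n) * n) + c₂ * (2 * (y % n * (y / n)) + y / n * (y / n) * n)) n))
  where
  expand : ∀ c₁ c₂ i k j l n →
    c₁ * ((i + k * n) * (i + k * n)) + c₂ * ((j + l * n) * (j + l * n)) ≡
    (c₁ * (i * i) + c₂ * (j * j)) +
    (c₁ * (2 * (i * k) + k * k * n) + c₂ * (2 * (j * l) + l * l * n)) * n
  expand = solve-∀

-- A finite table over residues. The value k x² is written `form k 0 x 0`, so that `form-%` reduces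
-- both sides of an equation. Keeping p apart from n allows the modulus 4 with p = 2.
Residues : (k p n : ℕ) .{{_ : NonZero n}} → (c₁ c₂ c₃ c₄ : ℕ) → Set
Residues k p n c₁ c₂ c₃ c₄ = ∀ (i j x z : Fin n) →
  form c₁ c₂ (toℕ i) (toℕ j) % n ≡ form k 0 (toℕ x) 0 % n →
  form c₃ c₄ (toℕ i) (toℕ j) % n ≡ form k 0 (toℕ z) 0 % n →
  p ∣ toℕ i × p ∣ toℕ j

residues? : ∀ k p n .{{_ : NonZero n}} c₁ c₂ c₃ c₄ → Dec (Residues k p n c₁ c₂ c₃ c₄)
residues? k p n c₁ c₂ c₃ c₄ = all? λ i → all? λ j → all? λ x → all? λ z →
  (_ ≟ _) →-dec ((_ ≟ _) →-dec ((p ∣? toℕ i) ×-dec (p ∣? toℕ j)))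

-- The residues of M, e, x and z form an entry of the table, so p divides the residues of M and e;
-- as p ∣ n it divides M and e themselves, against coprimality. Evaluation of the decision procedure
-- supplies `check`.
locally-insoluble : ∀ k p n .{{_ : NonTrivial p}} .{{_ : NonZero n}} c₁ c₂ c₃ c₄ → p ∣ n →
  True (residues? k p n c₁ c₂ c₃ c₄) → ∀ {M e x z} → Coprime M e →
  form c₁ c₂ M e ≡ k * (x * x) → ¬ form c₃ c₄ M e ≡ k * (z * z)
locally-insoluble k p n c₁ c₂ c₃ c₄ p∣n check {M} {e} {x} {z} M⊥e eq₁ eq₂ =
  nonTrivial⇒≢1 (M⊥e (∣n∣m%n⇒∣m p∣n (proj₁ common) , ∣n∣m%n⇒∣m p∣n (proj₂ common)))
  where
  res : ℕ → Fin n
  res m = fromℕ< (m%n<n m n)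
  res≡ : ∀ m → m % n ≡ toℕ (res m)
  res≡ m = sym (toℕ-fromℕ< (m%n<n m n))
  transfer : ∀ c₁ c₂ y → form c₁ c₂ M e ≡ k * (y * y) →
    form c₁ c₂ (toℕ (res M)) (toℕ (res e)) % n ≡ form k 0 (toℕ (res y)) 0 % n
  transfer c₁ c₂ y eq = begin
    form c₁ c₂ (toℕ (res M)) (toℕ (res e)) % n ≡⟨ cong₂ (λ s t → form c₁ c₂ s t % n) (res≡ M) (res≡ e) ⟨
    form c₁ c₂ (M % n) (e % n) % n             ≡⟨ form-% n c₁ c₂ M e ⟨
    form c₁ c₂ M e % n                         ≡⟨ cong (_% n) (trans eq (sym (+-identityʳ _))) ⟩
    form k 0 y 0 % n                           ≡⟨ form-% n k 0 y 0 ⟩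
    form k 0 (y % n) (0 % n) % n               ≡⟨ cong (λ s → form k 0 s (0 % n) % n) (res≡ y) ⟩
    form k 0 (toℕ (res y)) 0 % n               ∎
    where open ≡-Reasoning
  common : p ∣ M % n × p ∣ e % n
  common =
    let p∣M , p∣e = toWitness check (res M) (res e) (res x) (res z) (transfer c₁ c₂ x eq₁) (transfer c₃ c₄ z eq₂)
    in subst (p ∣_) (sym (res≡ M)) p∣M , subst (p ∣_) (sym (res≡ e)) p∣e

-- Common divisors and lists of divisors.

odd⇒coprime-2 : ∀ {n} → 2 ∤ n → Coprime n 2
odd⇒coprime-2 odd (d∣n , d∣2) with prime⇒irreducible 2-prime d∣2
... | inj₁ d≡1  = d≡1
... | inj₂ refl = contradiction d∣n odd

odd-∣2*⇒∣ : ∀ {m} n → 2 ∤ m → m ∣ 2 * n → m ∣ n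
odd-∣2*⇒∣ n odd = coprime-divisor (odd⇒coprime-2 odd)

-- The gcd of k a and k b is k. This turns an elimination between two forms into a bound on their
-- gcd.
coprime-∣⇒∣ : ∀ k {g a b} → Coprime a b → g ∣ k * a → g ∣ k * b → g ∣ k
coprime-∣⇒∣ k {g} {a} {b} a⊥b g∣ka g∣kb = subst (g ∣_)
  (trans (sym (c*gcd[m,n]≡gcd[cm,cn] k a b)) (trans (cong (k *_) (coprime⇒gcd≡1 a⊥b)) (*-identityʳ k)))
  (gcd-greatest g∣ka g∣kb)

bounded-divisors : ∀ n .{{_ : NonZero n}} {P : ℕ → Set} (P? : ∀ g → Dec (P g)) →
  True (all? {n = suc n} λ i → (toℕ i ∣? n) →-dec P? (toℕ i)) → ∀ {g} → g ∣ n → P g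
bounded-divisors n {P} P? check {g} g∣n = subst P i≡g (toWitness check i (subst (_∣ n) (sym i≡g) g∣n))
  where
  g<1+n = s≤s (∣⇒≤ g∣n)
  i = fromℕ< g<1+n
  i≡g : toℕ i ≡ g
  i≡g = toℕ-fromℕ< g<1+n

divisors-of-49 : ∀ {g} → g ∣ 49 → g ≡ 1 ⊎ g ≡ 7 ⊎ g ≡ 49
divisors-of-49 = bounded-divisors 49 (λ g → (g ≟ 1) ⊎-dec (g ≟ 7) ⊎-dec (g ≟ 49)) _

divisors-of-75 : ∀ {g} → g ∣ 75 → g ≡ 1 ⊎ g ≡ 3 ⊎ g ≡ 5 ⊎ g ≡ 15 ⊎ g ≡ 25 ⊎ g ≡ 75
divisors-of-75 = bounded-divisors 75
  (λ g → (g ≟ 1) ⊎-dec (g ≟ 3) ⊎-dec (g ≟ 5) ⊎-dec (g ≟ 15) ⊎-dec (g ≟ 25) ⊎-dec (g ≟ 75)) _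

-- The concordant forms and the second half of the descent.

-- An instance of Euler's concordant forms: x² + 625 y² and x² + 576 y² are squares together. The
-- index `Y` is the quantity that descends.
record Solution (Y : ℕ) : Set where
  field
    W X Z : ℕ
    W-odd : 2 ∤ W
    Y≢0   : NonZero Y
    XX≡   : W * W + 625 * (Y * Y) ≡ X * X
    ZZ≡   : W * W + 576 * (Y * Y) ≡ Z * Z

-- With r² − t² = d p² and r² − 2401 t² = d q², {u , u′} = {(p + q) / 2 , (p − q) / 2}.
record Halving (Y d : ℕ) : Set where
  field
    r t u u′ : ℕ
    t≢0   : NonZero t
    t<Y   : t < Y
    u-odd : 2 ∤ u
    uu′≡  : d * (u * u′) ≡ 600 * (t * t)
    rr≡   : r * r ≡ t * t + d * ((u + u′) * (u + u′))

-- `M / e` is `u / t` in lowest terms, and `k` is the common square class of the two forms. It comes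
-- from a divisor of 49, which leaves 1 and 7.
record SquareClasses (Y c₁ c₂ c₃ c₄ : ℕ) : Set where
  constructor classes
  field
    {M e k x z} : ℕ
    M⊥e   : Coprime M e
    e≢0   : NonZero e
    e<Y   : e < Y
    M-odd : 2 ∤ M
    k≡    : k ≡ 1 ⊎ k ≡ 7
    α≡    : form c₁ c₂ M e ≡ k * (x * x)
    β≡    : form c₃ c₄ M e ≡ k * (z * z)

-- For d = c₁ c₃ one has (d M² + 625 e²) (d M² + 576 e²) = d α β, and the resultant
-- c₂ c₃ − c₁ c₄ of α and β is 49.
halved-classes : ∀ c₁ c₂ c₃ c₄ {{_ : NonZero c₁}} {{_ : NonZero c₃}} →
  c₃ * c₂ ≡ 625 → c₁ * c₄ ≡ 576 → ∀ {Y} (H : Halving Y (c₁ * c₃)) →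
  SquareClasses Y c₁ c₂ c₃ c₄
halved-classes c₁ c₂ c₃ c₄ c₃c₂≡ c₁c₄≡ {Y} H =
  let f≢0 , M , e , u≡ , t≡ , M⊥e = reduce-fraction u t {{t≢0}}
  in from-lowest-terms (gcd u t) {{f≢0}} M e u≡ t≡ M⊥e
  where
  open Halving H
  d = c₁ * c₃
  from-lowest-terms : ∀ f {{_ : NonZero f}} M e → u ≡ f * M → t ≡ f * e → Coprime M e → SquareClasses Y c₁ c₂ c₃ c₄
  from-lowest-terms f {{f≢0}} M e u≡ t≡ M⊥e =
    let k , x , z , k≡ , α≡ , β≡ = split in classes {M = M} {e} {k} {x} {z} M⊥e e≢0 e<Y M-odd k≡ α≡ β≡
    where
    e≢0 : NonZero e
    e≢0 = m*n≢0⇒n≢0 f {e} {{subst NonZero t≡ t≢0}}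
    e<Y : e < Y
    e<Y = ≤-<-trans (subst (e ≤_) (sym t≡) (m≤n*m e f)) t<Y
    M-odd : 2 ∤ M
    M-odd 2∣M = u-odd (subst (2 ∣_) (sym u≡) (∣n⇒∣m*n f 2∣M))
    α = form c₁ c₂ M e
    β = form c₃ c₄ M e
    M≢0 = odd⇒≢0 M-odd
    form≢0 : ∀ c c′ {{_ : NonZero c}} → NonZero (form c c′ M e)
    form≢0 c c′ {{c≢0}} = >-nonZero (<-≤-trans (>-nonZero⁻¹ (c * (M * M)) {{m*n≢0 c (M * M) {{c≢0}} {{m*n≢0 M M {{M≢0}} {{M≢0}}}}}})
      (m≤m+n (c * (M * M)) (c′ * (e * e))))
    -- This eliminates u′ without division: d M u′ is a multiple of f.
    dMu′≡ : d * (M * u′) ≡ 600 * (f * (e * e))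
    dMu′≡ = *-cancelˡ-≡ _ _ f (begin
      f * (d * (M * u′))       ≡⟨ a₁ f d M u′ ⟩
      d * (f * M * u′)         ≡⟨ cong (λ x → d * (x * u′)) u≡ ⟨
      d * (u * u′)             ≡⟨ uu′≡ ⟩
      600 * (t * t)            ≡⟨ cong (λ x → 600 * (x * x)) t≡ ⟩
      600 * (f * e * (f * e))  ≡⟨ a₂ f e ⟩
      f * (600 * (f * (e * e))) ∎)
      where
      open ≡-Reasoning
      a₁ : ∀ f d M u′ → f * (d * (M * u′)) ≡ d * (f * M * u′)
      a₁ = solve-∀
      a₂ : ∀ f e → 600 * (f * e * (f * e)) ≡ f * (600 * (f * (e * e)))
      a₂ = solve-∀
    -- Multiply `rr≡` by d M² and insert d M u′ = 600 f e². The quartic in M and e factors because 1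
    -- + 2 · 600 = 625 + 576 and 600² = 625 · 576.
    dα*β≡ : d * (M * r * (M * r)) ≡ d * (f * α * (f * β))
    dα*β≡ = begin
      d * (M * r * (M * r)) ≡⟨ a₁ d M r ⟩
      d * (M * M) * (r * r) ≡⟨ cong (d * (M * M) *_) (trans rr≡ (cong₂ (λ x y → x * x + d * ((y + u′) * (y + u′))) t≡ u≡)) ⟩
      d * (M * M) * (f * e * (f * e) + d * ((f * M + u′) * (f * M + u′))) ≡⟨ a₂ d M f e u′ ⟩
      d * (M * M) * (f * e * (f * e)) + (f * d * (M * M) + d * (M * u′)) * (f * d * (M * M) + d * (M * u′))
        ≡⟨ cong (λ x → d * (M * M) * (f * e * (f * e)) + (f * d * (M * M) + x) * (f * d * (M * M) + x)) dMu′≡ ⟩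
      d * (M * M) * (f * e * (f * e)) + (f * d * (M * M) + 600 * (f * (e * e))) * (f * d * (M * M) + 600 * (f * (e * e)))
        ≡⟨ a₃ d M f e ⟩
      f * f * ((d * (M * M) + 625 * (e * e)) * (d * (M * M) + 576 * (e * e)))
        ≡⟨ unfold c₃c₂≡ c₁c₄≡ ⟩
      f * f * ((d * (M * M) + c₃ * c₂ * (e * e)) * (d * (M * M) + c₁ * c₄ * (e * e)))
        ≡⟨ a₄ f c₁ c₂ c₃ c₄ M e ⟩
      d * (f * α * (f * β)) ∎
      where
      open ≡-Reasoning
      a₁ : ∀ d M r → d * (M * r * (M * r)) ≡ d * (M * M) * (r * r)
      a₁ = solve-∀
      a₂ : ∀ d M f e u′ → d * (M * M) * (f * e * (f * e) + d * ((f * M + u′) * (f * M + u′))) ≡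
        d * (M * M) * (f * e * (f * e)) + (f * d * (M * M) + d * (M * u′)) * (f * d * (M * M) + d * (M * u′))
      a₂ = solve-∀
      a₃ : ∀ d M f e → d * (M * M) * (f * e * (f * e)) +
        (f * d * (M * M) + 600 * (f * (e * e))) * (f * d * (M * M) + 600 * (f * (e * e))) ≡
        f * f * ((d * (M * M) + 625 * (e * e)) * (d * (M * M) + 576 * (e * e)))
      a₃ = solve-∀
      unfold : ∀ {x y} → c₃ * c₂ ≡ x → c₁ * c₄ ≡ y →
        f * f * ((d * (M * M) + x * (e * e)) * (d * (M * M) + y * (e * e))) ≡
        f * f * ((d * (M * M) + c₃ * c₂ * (e * e)) * (d * (M * M) + c₁ * c₄ * (e * e)))
      unfold refl refl = refl
      a₄ : ∀ f c₁ c₂ c₃ c₄ M e →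
        f * f * ((c₁ * c₃ * (M * M) + c₃ * c₂ * (e * e)) * (c₁ * c₃ * (M * M) + c₁ * c₄ * (e * e))) ≡
        c₁ * c₃ * (f * (c₁ * (M * M) + c₂ * (e * e)) * (f * (c₃ * (M * M) + c₄ * (e * e))))
      a₄ = solve-∀
    αβ≡ : f * α * (f * β) ≡ M * r * (M * r)
    αβ≡ = sym (*-cancelˡ-≡ _ _ d {{m*n≢0 c₁ c₃}} dα*β≡)
    -- The gcd divides c₂ β - c₄ α = 49 M² and c₃ α - c₁ β = 49 e², where 49 = 625 - 576.
    g∣49 : gcd α β ∣ 49
    g∣49 = coprime-∣⇒∣ 49 (coprime-square M⊥e)
      (∣m+n∣m⇒∣n (subst (gcd α β ∣_) eq₁ (∣n⇒∣m*n c₂ (gcd[m,n]∣n α β))) (∣n⇒∣m*n c₄ (gcd[m,n]∣m α β)))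
      (∣m+n∣m⇒∣n (subst (gcd α β ∣_) eq₂ (∣n⇒∣m*n c₃ (gcd[m,n]∣m α β))) (∣n⇒∣m*n c₁ (gcd[m,n]∣n α β)))
      where
      arrange₁ : ∀ c₁ c₂ c₃ c₄ M e → c₂ * (c₃ * (M * M) + c₄ * (e * e)) ≡ c₃ * c₂ * (M * M) + c₂ * c₄ * (e * e)
      arrange₁ = solve-∀
      arrange₁′ : ∀ c₁ c₂ c₃ c₄ M e → (c₁ * c₄ + 49) * (M * M) + c₂ * c₄ * (e * e) ≡
        c₄ * (c₁ * (M * M) + c₂ * (e * e)) + 49 * (M * M)
      arrange₁′ = solve-∀
      det : c₃ * c₂ ≡ c₁ * c₄ + 49
      det = trans c₃c₂≡ (sym (cong (_+ 49) c₁c₄≡))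
      eq₁ : c₂ * β ≡ c₄ * α + 49 * (M * M)
      eq₁ = trans (arrange₁ c₁ c₂ c₃ c₄ M e) (trans (cong (λ x → x * (M * M) + c₂ * c₄ * (e * e)) det)
              (arrange₁′ c₁ c₂ c₃ c₄ M e))
      arrange₂ : ∀ c₁ c₂ c₃ M e → c₃ * (c₁ * (M * M) + c₂ * (e * e)) ≡ c₁ * c₃ * (M * M) + c₃ * c₂ * (e * e)
      arrange₂ = solve-∀
      arrange₂′ : ∀ c₁ c₃ c₄ M e → c₁ * c₃ * (M * M) + (c₁ * c₄ + 49) * (e * e) ≡
        c₁ * (c₃ * (M * M) + c₄ * (e * e)) + 49 * (e * e)
      arrange₂′ = solve-∀
      eq₂ : c₃ * α ≡ c₁ * β + 49 * (e * e)
      eq₂ = trans (arrange₂ c₁ c₂ c₃ M e) (trans (cong (λ x → c₁ * c₃ * (M * M) + x * (e * e)) det)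
              (arrange₂′ c₁ c₃ c₄ M e))
    normalise : ∀ {g} p q → g ∣ 49 → α ≡ g * (p * p) → β ≡ g * (q * q) →
      ∃₂ λ k x → ∃ λ z → (k ≡ 1 ⊎ k ≡ 7) × α ≡ k * (x * x) × β ≡ k * (z * z)
    normalise {g} p q g∣49 α≡ β≡ with divisors-of-49 g∣49
    ... | inj₁ refl        = 1 , p , q , inj₁ refl , α≡ , β≡
    ... | inj₂ (inj₁ refl) = 7 , p , q , inj₂ refl , α≡ , β≡
    ... | inj₂ (inj₂ refl) = 1 , 7 * p , 7 * q , inj₁ refl , trans α≡ (absorb p) , trans β≡ (absorb q)
      where
      absorb : ∀ p → 49 * (p * p) ≡ 1 * (7 * p * (7 * p))
      absorb = solve-∀
    split : ∃₂ λ k x → ∃ λ z → (k ≡ 1 ⊎ k ≡ 7) × α ≡ k * (x * x) × β ≡ k * (z * z)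
    split = let p , q , α≡ , β≡ = square-class-scaled f α β {M * r} {{f≢0}} {{form≢0 c₁ c₂}} {{form≢0 c₃ c₄}} αβ≡
            in normalise p q g∣49 α≡ β≡

-- The first half of the descent.

-- For r / t = (X + Z) / Y in lowest terms, N = r² − 2401 t² and N + 2400 t² = r² − t².
record Quotient (Y : ℕ) : Set where
  field
    r t N h c : ℕ
    r⊥t   : Coprime r t
    t≢0   : NonZero t
    h≢0   : NonZero h
    N≢0   : NonZero N
    t<Y   : t < Y
    rr≡   : r * r ≡ N + 2401 * (t * t)
    K-odd : 2 ∤ N + 2400 * (t * t)
    cc≡   : h * (N + 2400 * (t * t)) * (h * N) ≡ c * c

-- The conic X² - Z² = 49 Y² is parametrised by (X + Z) / Y. With S = X + Z = h r and m = X - Z one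
-- has S m = 49 Y² and 2 X = S + m; inserted into the equation for X² this gives 4 r² W² = h² (r² -
-- t²) (r² - 2401 t²).
toQuotient : ∀ {Y} → Solution Y → Quotient Y
toQuotient {Y} sol =
  let h≢0 , r , t , S≡ , Y≡ , r⊥t = reduce-fraction S Y {{Y≢0}}
  in from-lowest-terms (gcd S Y) {{h≢0}} r t S≡ Y≡ r⊥t
  where
  open Solution sol
  open ≡-Reasoning
  XX≡ZZ+49YY : X * X ≡ Z * Z + 49 * (Y * Y)
  XX≡ZZ+49YY = trans (sym XX≡) (trans (arrange W Y) (cong (_+ 49 * (Y * Y)) ZZ≡))
    where
    arrange : ∀ W Y → W * W + 625 * (Y * Y) ≡ W * W + 576 * (Y * Y) + 49 * (Y * Y)
    arrange = solve-∀
  Z≤X : Z ≤ X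
  Z≤X = square-cancel-≤ (subst (Z * Z ≤_) (sym XX≡ZZ+49YY) (m≤m+n (Z * Z) (49 * (Y * Y))))
  m = X ∸ Z
  X≡ : X ≡ Z + m
  X≡ = sym (m+[n∸m]≡n Z≤X)
  S = Z + Z + m
  Sm≡ : S * m ≡ 49 * (Y * Y)
  Sm≡ = +-cancelˡ-≡ (Z * Z) _ _ (trans (arrange Z m) (trans (cong (λ x → x * x) (sym X≡)) XX≡ZZ+49YY))
    where
    arrange : ∀ Z m → Z * Z + (Z + Z + m) * m ≡ (Z + m) * (Z + m)
    arrange = solve-∀
  from-lowest-terms : ∀ h {{_ : NonZero h}} r t → S ≡ h * r → Y ≡ h * t → Coprime r t → Quotient Y
  from-lowest-terms h {{h≢0}} r t S≡ Y≡ r⊥t = record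
    { r = r ; t = t ; N = N ; h = h ; c = 2 * (r * W) ; r⊥t = r⊥t ; t≢0 = t≢0 ; h≢0 = h≢0
    ; N≢0 = N≢0 ; t<Y = t<Y ; rr≡ = rr≡ ; K-odd = K-odd ; cc≡ = cc≡ }
    where
    t≢0 : NonZero t
    t≢0 = m*n≢0⇒n≢0 h {t} {{subst NonZero Y≡ Y≢0}}
    W≢0 = odd⇒≢0 W-odd
    rm≡ : r * m ≡ 49 * h * (t * t)
    rm≡ = *-cancelˡ-≡ _ _ h (begin
      h * (r * m)              ≡⟨ *-assoc h r m ⟨
      h * r * m                ≡⟨ cong (_* m) S≡ ⟨
      S * m                    ≡⟨ Sm≡ ⟩
      49 * (Y * Y)             ≡⟨ cong (λ y → 49 * (y * y)) Y≡ ⟩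
      49 * (h * t * (h * t))   ≡⟨ arrange h t ⟩
      h * (49 * h * (t * t))   ∎)
      where
      arrange : ∀ h t → 49 * (h * t * (h * t)) ≡ h * (49 * h * (t * t))
      arrange = solve-∀
    rm≢0 : NonZero (r * m)
    rm≢0 = subst NonZero (sym rm≡) (m*n≢0 (49 * h) (t * t) {{m*n≢0 49 h}} {{m*n≢0 t t {{t≢0}} {{t≢0}}}})
    r≢0 : NonZero r
    r≢0 = m*n≢0⇒m≢0 r {m} {{rm≢0}}
    r∣49h : r ∣ 49 * h
    r∣49h = coprime-divisor r⊥t (coprime-divisor r⊥t (subst (r ∣_) (trans rm≡ (arrange h t)) (m∣m*n m)))
      where
      arrange : ∀ h t → 49 * h * (t * t) ≡ t * (t * (49 * h))
      arrange = solve-∀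
    r≤49h : r ≤ 49 * h
    r≤49h = ∣⇒≤ {{m*n≢0 49 h}} r∣49h
    2X≡ : 2 * X ≡ h * r + m
    2X≡ = trans (cong (2 *_) X≡) (trans (arrange Z m) (cong (_+ m) S≡))
      where
      arrange : ∀ Z m → 2 * (Z + m) ≡ Z + Z + m + m
      arrange = solve-∀
    -- The equation for X², multiplied by 4 r² and stated without subtraction; 2500 is 4 · 625.
    main : 4 * (r * r * (W * W)) + 2500 * (h * h * (r * r) * (t * t)) ≡
           h * h * ((r * r + 49 * (t * t)) * (r * r + 49 * (t * t)))
    main = begin
      4 * (r * r * (W * W)) + 2500 * (h * h * (r * r) * (t * t)) ≡⟨ a₁ h r t W ⟩
      4 * (r * r * (W * W + 625 * (h * t * (h * t))))            ≡⟨ cong (λ y → 4 * (r * r * (W * W + 625 * (y * y)))) Y≡ ⟨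
      4 * (r * r * (W * W + 625 * (Y * Y)))                      ≡⟨ cong (λ y → 4 * (r * r * y)) XX≡ ⟩
      4 * (r * r * (X * X))                                      ≡⟨ a₂ r X ⟩
      r * (2 * X) * (r * (2 * X))                                ≡⟨ cong (λ y → r * y * (r * y)) 2X≡ ⟩
      r * (h * r + m) * (r * (h * r + m))                        ≡⟨ a₃ r h m ⟩
      (h * (r * r) + r * m) * (h * (r * r) + r * m)              ≡⟨ cong (λ y → (h * (r * r) + y) * (h * (r * r) + y)) rm≡ ⟩
      (h * (r * r) + 49 * h * (t * t)) * (h * (r * r) + 49 * h * (t * t)) ≡⟨ a₄ h (r * r) (t * t) ⟩
      h * h * ((r * r + 49 * (t * t)) * (r * r + 49 * (t * t)))  ∎
      where
      a₁ : ∀ h r t W → 4 * (r * r * (W * W)) + 2500 * (h * h * (r * r) * (t * t)) ≡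
        4 * (r * r * (W * W + 625 * (h * t * (h * t))))
      a₁ = solve-∀
      a₂ : ∀ r X → 4 * (r * r * (X * X)) ≡ r * (2 * X) * (r * (2 * X))
      a₂ = solve-∀
      a₃ : ∀ r h m → r * (h * r + m) * (r * (h * r + m)) ≡ (h * (r * r) + r * m) * (h * (r * r) + r * m)
      a₃ = solve-∀
      a₄ : ∀ h R T → (h * R + 49 * h * T) * (h * R + 49 * h * T) ≡ h * h * ((R + 49 * T) * (R + 49 * T))
      a₄ = solve-∀
    tt≤rr : t * t ≤ r * r
    tt≤rr = *-cancelˡ-≤ h (≤-trans (*-monoˡ-≤ (t * t) (m≤n*m h 49))
      (subst₂ _≤_ rm≡ (arrange r h) (*-monoʳ-≤ r (subst (m ≤_) S≡ (m≤n+m m (Z + Z))))))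
      where
      arrange : ∀ r h → r * (h * r) ≡ h * (r * r)
      arrange = solve-∀
    -- Otherwise i = r² - t² and j = 2401 t² - r² are both natural and `main` reads 4 r² W² + h² i j
    -- = 0, although r and W are nonzero.
    rr≰ : ¬ r * r ≤ 2401 * (t * t)
    rr≰ rr≤ = ≢-nonZero⁻¹ (4 * (r * r * (W * W)))
      {{m*n≢0 4 (r * r * (W * W)) {{_}} {{m*n≢0 (r * r) (W * W) {{m*n≢0 r r {{r≢0}} {{r≢0}}}} {{m*n≢0 W W {{W≢0}} {{W≢0}}}}}}}}
      (m+n≡0⇒m≡0 _ vanish)
      where
      i = r * r ∸ t * t
      j = 2401 * (t * t) ∸ r * r
      R≡ : r * r ≡ t * t + i
      R≡ = sym (m+[n∸m]≡n tt≤rr)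
      i+j≡ : i + j ≡ 2400 * (t * t)
      i+j≡ = +-cancelˡ-≡ (t * t) _ _ (begin
        t * t + (i + j) ≡⟨ +-assoc (t * t) i j ⟨
        t * t + i + j   ≡⟨ cong (_+ j) R≡ ⟨
        r * r + j       ≡⟨ m+[n∸m]≡n rr≤ ⟩
        2401 * (t * t)  ≡⟨⟩
        t * t + 2400 * (t * t) ∎)
      identity : ∀ h T i j R → R ≡ T + i → i + j ≡ 2400 * T →
        h * h * ((R + 49 * T) * (R + 49 * T)) + h * h * (i * j) ≡ 2500 * (h * h * R * T)
      identity h T i j R refl i+j≡ = begin
        h * h * ((T + i + 49 * T) * (T + i + 49 * T)) + h * h * (i * j) ≡⟨ a₁ h T i j ⟩
        h * h * (2500 * (T * T) + 100 * (T * i) + i * (i + j)) ≡⟨ cong (λ y → h * h * (2500 * (T * T) + 100 * (T * i) + i * y)) i+j≡ ⟩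
        h * h * (2500 * (T * T) + 100 * (T * i) + i * (2400 * T)) ≡⟨ a₂ h T i ⟩
        2500 * (h * h * (T + i) * T) ∎
        where
        a₁ : ∀ h T i j → h * h * ((T + i + 49 * T) * (T + i + 49 * T)) + h * h * (i * j) ≡
          h * h * (2500 * (T * T) + 100 * (T * i) + i * (i + j))
        a₁ = solve-∀
        a₂ : ∀ h T i → h * h * (2500 * (T * T) + 100 * (T * i) + i * (2400 * T)) ≡ 2500 * (h * h * (T + i) * T)
        a₂ = solve-∀
      vanish : 4 * (r * r * (W * W)) + h * h * (i * j) ≡ 0
      vanish = +-cancelʳ-≡ (2500 * (h * h * (r * r) * (t * t))) _ _ (begin
        4 * (r * r * (W * W)) + h * h * (i * j) + 2500 * (h * h * (r * r) * (t * t))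
          ≡⟨ swap (4 * (r * r * (W * W))) (h * h * (i * j)) (2500 * (h * h * (r * r) * (t * t))) ⟩
        4 * (r * r * (W * W)) + 2500 * (h * h * (r * r) * (t * t)) + h * h * (i * j)
          ≡⟨ cong (_+ h * h * (i * j)) main ⟩
        h * h * ((r * r + 49 * (t * t)) * (r * r + 49 * (t * t))) + h * h * (i * j)
          ≡⟨ identity h (t * t) i j (r * r) R≡ i+j≡ ⟩
        2500 * (h * h * (r * r) * (t * t)) ∎)
        where
        swap : ∀ x y z → x + y + z ≡ x + z + y
        swap = solve-∀
    rr> : 2401 * (t * t) < r * r
    rr> = ≰⇒> rr≰
    N = r * r ∸ 2401 * (t * t)
    K = N + 2400 * (t * t)
    N≢0 : NonZero N
    N≢0 = >-nonZero (m<n⇒0<n∸m rr>)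
    rr≡ : r * r ≡ N + 2401 * (t * t)
    rr≡ = sym (m∸n+n≡m (<⇒≤ rr>))
    t<Y : t < Y
    t<Y = subst (t <_) (sym Y≡) (subst (_< h * t) (*-identityˡ t) (*-monoˡ-< t {{t≢0}} 1<h))
      where
      -- For h ≤ 1 the bound r ≤ 49 h would give r² ≤ 49² = 2401 ≤ 2401 t².
      1<h : 1 < h
      1<h = ≰⇒> λ h≤1 → rr≰ (≤-trans
        (*-mono-≤ {r} {49} {r} {49} (≤-trans r≤49h (*-monoʳ-≤ 49 h≤1)) (≤-trans r≤49h (*-monoʳ-≤ 49 h≤1)))
        (m≤m*n 2401 (t * t) {{m*n≢0 t t {{t≢0}} {{t≢0}}}}))
    cc≡ : h * K * (h * N) ≡ 2 * (r * W) * (2 * (r * W))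
    cc≡ = +-cancelʳ-≡ (2500 * (h * h * (r * r) * (t * t))) _ _ (begin
      h * K * (h * N) + 2500 * (h * h * (r * r) * (t * t))
        ≡⟨ cong (λ y → h * K * (h * N) + 2500 * (h * h * y * (t * t))) rr≡ ⟩
      h * K * (h * N) + 2500 * (h * h * (N + 2401 * (t * t)) * (t * t))
        ≡⟨ a₁ h N (t * t) ⟩
      h * h * ((N + 2401 * (t * t) + 49 * (t * t)) * (N + 2401 * (t * t) + 49 * (t * t)))
        ≡⟨ cong (λ y → h * h * ((y + 49 * (t * t)) * (y + 49 * (t * t)))) rr≡ ⟨
      h * h * ((r * r + 49 * (t * t)) * (r * r + 49 * (t * t))) ≡⟨ main ⟨
      4 * (r * r * (W * W)) + 2500 * (h * h * (r * r) * (t * t)) ≡⟨ cong (_+ 2500 * (h * h * (r * r) * (t * t))) (a₂ r W) ⟩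
      2 * (r * W) * (2 * (r * W)) + 2500 * (h * h * (r * r) * (t * t)) ∎)
      where
      a₁ : ∀ h N T → h * (N + 2400 * T) * (h * N) + 2500 * (h * h * (N + 2401 * T) * T) ≡
        h * h * ((N + 2401 * T + 49 * T) * (N + 2401 * T + 49 * T))
      a₁ = solve-∀
      a₂ : ∀ r W → 4 * (r * r * (W * W)) ≡ 2 * (r * W) * (2 * (r * W))
      a₂ = solve-∀
    rr≡K+tt : r * r ≡ K + t * t
    rr≡K+tt = trans rr≡ (arrange N (t * t))
      where
      arrange : ∀ N T → N + 2401 * T ≡ N + 2400 * T + T
      arrange = solve-∀
    -- If r and t were both odd then 16 ∣ K N, against K N h² = 4 r² W² with r W odd.
    both-odd : 2 ∤ r → 2 ∤ t → ⊥
    both-odd r-odd t-odd = [ r-odd , W-odd ]′ (euclidsLemma r W 2-prime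
        (*-cancelˡ-∣ 2 (square-∣ 4 (2 * (r * W)) (subst (16 ∣_) cc≡ (*-pres-∣ (∣n⇒∣m*n h 4∣K) (∣n⇒∣m*n h 4∣N))))))
      where
      4∣K : 4 ∣ K
      4∣K = let i , rr≡1 = odd-square r r-odd
                j , tt≡1 = odd-square t t-odd
                eq : 8 * j + K ≡ 8 * i
                eq = +-cancelʳ-≡ 1 _ _ (trans (arrange₁ j K) (trans (cong (_+_ K) (sym tt≡1))
                       (trans (sym rr≡K+tt) (trans rr≡1 (+-comm 1 (8 * i))))))
            in ∣-trans (divides 2 refl) (∣m+n∣m⇒∣n (subst (8 ∣_) (sym eq) (m∣m*n i)) (m∣m*n j))
        where
        arrange₁ : ∀ j K → 8 * j + K + 1 ≡ K + (1 + 8 * j)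
        arrange₁ = solve-∀
      4∣N : 4 ∣ N
      4∣N = ∣m+n∣m⇒∣n (subst (4 ∣_) (+-comm N (2400 * (t * t))) 4∣K) (∣m⇒∣m*n (t * t) (divides 600 refl))
    -- K is r² - t², so an even K means equal parities of r and t: both odd is excluded above, both
    -- even by `r⊥t`.
    K-odd : 2 ∤ K
    K-odd 2∣K with 2 ∣? r
    ... | no r-odd = both-odd r-odd λ 2∣t →
          r-odd (2∣square⇒2∣ r (subst (2 ∣_) (sym rr≡K+tt) (∣m∣n⇒∣m+n 2∣K (∣m⇒∣m*n t 2∣t))))
    ... | yes 2∣r = contradiction (r⊥t (2∣r , 2∣square⇒2∣ t (∣m+n∣m⇒∣n (subst (2 ∣_) rr≡K+tt (∣m⇒∣m*n r 2∣r)) 2∣K))) λ ()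

-- K is odd, hence so are p and q, and p = q + 2 w. Then d (p² - q²) = 2400 t² becomes d w (w + q) =
-- 600 t². As q is odd, exactly one of w and w + q is odd; that one serves as u.
halving-from-classes : ∀ {Y} (Q : Quotient Y) → let open Quotient Q in ∀ d {{_ : NonZero d}} p q →
  N + 2400 * (t * t) ≡ d * (p * p) → N ≡ d * (q * q) → Halving Y d
halving-from-classes {Y} Q d {{d≢0}} p q K≡ N≡ = choose (2 ∣? w)
  where
  open Quotient Q
  dpp≡ : d * (p * p) ≡ d * (q * q) + 2400 * (t * t)
  dpp≡ = trans (sym K≡) (cong (_+ 2400 * (t * t)) N≡)
  q≤p : q ≤ p
  q≤p = square-cancel-≤ (*-cancelˡ-≤ d (subst (d * (q * q) ≤_) (sym dpp≡) (m≤m+n _ _)))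
  p-odd : 2 ∤ p
  p-odd 2∣p = K-odd (subst (2 ∣_) (sym K≡) (∣n⇒∣m*n d (∣m⇒∣m*n p 2∣p)))
  q-odd : 2 ∤ q
  q-odd 2∣q = K-odd (∣m∣n⇒∣m+n (subst (2 ∣_) (sym N≡) (∣n⇒∣m*n d (∣m⇒∣m*n q 2∣q)))
                                (∣m⇒∣m*n {m = 2400} (t * t) (divides 1200 refl)))
  2∣p∸q : 2 ∣ p ∸ q
  2∣p∸q = odd∸odd p-odd q-odd q≤p
  w = quotient 2∣p∸q
  p≡ : p ≡ w + (w + q)
  p≡ = trans (sym (m+[n∸m]≡n q≤p)) (trans (cong (_+_ q) (m∣n⇒n≡quotient*m 2∣p∸q)) (arrange q w))
    where
    arrange : ∀ q w → q + w * 2 ≡ w + (w + q)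
    arrange = solve-∀
  ww+q≡ : d * (w * (w + q)) ≡ 600 * (t * t)
  ww+q≡ = *-cancelˡ-≡ _ _ 4 (+-cancelˡ-≡ (d * (q * q)) _ _ (trans (arrange₁ d q w)
            (trans (cong (λ x → d * (x * x)) (sym p≡)) (trans dpp≡ (arrange₂ (d * (q * q)) (t * t))))))
    where
    arrange₁ : ∀ d q w → d * (q * q) + 4 * (d * (w * (w + q))) ≡ d * ((w + (w + q)) * (w + (w + q)))
    arrange₁ = solve-∀
    arrange₂ : ∀ x T → x + 2400 * T ≡ x + 4 * (600 * T)
    arrange₂ = solve-∀
  rr≡′ : r * r ≡ t * t + d * (p * p)
  rr≡′ = trans rr≡ (trans (arrange N (t * t)) (cong (_+_ (t * t)) K≡))
    where
    arrange : ∀ N T → N + 2401 * T ≡ T + (N + 2400 * T)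
    arrange = solve-∀
  choose : Dec (2 ∣ w) → Halving Y d
  choose (no w-odd) = record { r = r ; t = t ; u = w ; u′ = w + q ; t≢0 = t≢0 ; t<Y = t<Y ; u-odd = w-odd
    ; uu′≡ = ww+q≡ ; rr≡ = trans rr≡′ (cong (λ x → t * t + d * (x * x)) p≡) }
  choose (yes 2∣w) = record { r = r ; t = t ; u = w + q ; u′ = w ; t≢0 = t≢0 ; t<Y = t<Y
    ; u-odd = λ 2∣w+q → q-odd (∣m+n∣m⇒∣n 2∣w+q 2∣w)
    ; uu′≡ = trans (cong (d *_) (*-comm (w + q) w)) ww+q≡
    ; rr≡ = trans rr≡′ (cong (λ x → t * t + d * (x * x)) (trans p≡ (+-comm w (w + q)))) }

-- The gcd g of K and N divides K - N = 2400 t² and 2401 K - N = 2400 r², hence 2400. The class of g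
-- modulo squares is d.
toHalving : ∀ {Y} → Quotient Y → Halving Y 1 ⊎ Halving Y 3 ⊎ Halving Y 5 ⊎ Halving Y 15
toHalving {Y} Q = let p , q , K≡ , N≡ = KN-classes in normalise g p q K≡ N≡ (divisors-of-75 g∣75)
  where
  open Quotient Q
  K = N + 2400 * (t * t)
  g = gcd K N
  g∣K = gcd[m,n]∣m K N
  g∣N = gcd[m,n]∣n K N
  g-odd : 2 ∤ g
  g-odd 2∣g = K-odd (∣-trans 2∣g g∣K)
  g∣2400 : g ∣ 2400
  g∣2400 = coprime-∣⇒∣ 2400 (coprime-square r⊥t)
    (∣m+n∣m⇒∣n (subst (g ∣_) (trans (arrange N (t * t)) (cong (λ x → N + 2400 * x) (sym rr≡))) (∣n⇒∣m*n 2401 g∣K)) g∣N)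
    (∣m+n∣m⇒∣n g∣K g∣N)
    where
    arrange : ∀ N T → 2401 * (N + 2400 * T) ≡ N + 2400 * (N + 2401 * T)
    arrange = solve-∀
  -- 2400 = 2⁵ · 75 and g is odd, so five factors 2 are removed.
  g∣75 : g ∣ 75
  g∣75 = odd-∣2*⇒∣ 75 g-odd (odd-∣2*⇒∣ 150 g-odd (odd-∣2*⇒∣ 300 g-odd (odd-∣2*⇒∣ 600 g-odd (odd-∣2*⇒∣ 1200 g-odd g∣2400))))
  K≢0 : NonZero K
  K≢0 = odd⇒≢0 K-odd
  KN-classes : ∃₂ λ p q → K ≡ g * (p * p) × N ≡ g * (q * q)
  KN-classes = square-class-scaled h K N {c} {{h≢0}} {{K≢0}} {{N≢0}} cc≡
  normalise : ∀ g p q → K ≡ g * (p * p) → N ≡ g * (q * q) →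
    g ≡ 1 ⊎ g ≡ 3 ⊎ g ≡ 5 ⊎ g ≡ 15 ⊎ g ≡ 25 ⊎ g ≡ 75 →
    Halving Y 1 ⊎ Halving Y 3 ⊎ Halving Y 5 ⊎ Halving Y 15
  normalise g p q K≡ N≡ = cases
    where
    halving : ∀ d {{_ : NonZero d}} → g ≡ d → Halving Y d
    halving d refl = halving-from-classes Q d p q K≡ N≡
    halving-25 : ∀ d {{_ : NonZero d}} → g ≡ 25 * d → Halving Y d
    halving-25 d g≡ = halving-from-classes Q d (5 * p) (5 * q)
      (trans K≡ (trans (cong (_* (p * p)) g≡) (absorb d p))) (trans N≡ (trans (cong (_* (q * q)) g≡) (absorb d q)))
      where
      absorb : ∀ d p → 25 * d * (p * p) ≡ d * (5 * p * (5 * p))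
      absorb = solve-∀
    cases : g ≡ 1 ⊎ g ≡ 3 ⊎ g ≡ 5 ⊎ g ≡ 15 ⊎ g ≡ 25 ⊎ g ≡ 75 →
      Halving Y 1 ⊎ Halving Y 3 ⊎ Halving Y 5 ⊎ Halving Y 15
    cases (inj₁ g≡)                                     = inj₁ (halving 1 g≡)
    cases (inj₂ (inj₁ g≡))                              = inj₂ (inj₁ (halving 3 g≡))
    cases (inj₂ (inj₂ (inj₁ g≡)))                       = inj₂ (inj₂ (inj₁ (halving 5 g≡)))
    cases (inj₂ (inj₂ (inj₂ (inj₁ g≡))))                = inj₂ (inj₂ (inj₂ (halving 15 g≡)))
    cases (inj₂ (inj₂ (inj₂ (inj₂ (inj₁ g≡)))))         = inj₁ (halving-25 1 g≡)
    cases (inj₂ (inj₂ (inj₂ (inj₂ (inj₂ g≡)))))         = inj₂ (inj₁ (halving-25 3 g≡))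

-- Local obstructions and the end of the descent.

-- The class k = 1 is excluded modulo p, the class k = 7 modulo 4, where 7 is -1.
insoluble : ∀ p .{{_ : NonTrivial p}} .{{_ : NonZero p}} c₁ c₂ c₃ c₄ →
  True (residues? 1 p p c₁ c₂ c₃ c₄) → True (residues? 7 2 4 c₁ c₂ c₃ c₄) →
  ∀ {Y} → ¬ SquareClasses Y c₁ c₂ c₃ c₄
insoluble p c₁ c₂ c₃ c₄ check₁ _ (classes {M} {e} {_} {x} {z} M⊥e _ _ _ (inj₁ refl) α≡ β≡) =
  locally-insoluble 1 p p c₁ c₂ c₃ c₄ ∣-refl check₁ {M} {e} {x} {z} M⊥e α≡ β≡
insoluble p c₁ c₂ c₃ c₄ _ check₇ (classes {M} {e} {_} {x} {z} M⊥e _ _ _ (inj₂ refl) α≡ β≡) =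
  locally-insoluble 7 2 4 c₁ c₂ c₃ c₄ (divides 2 refl) check₇ {M} {e} {x} {z} M⊥e α≡ β≡

-- The factor 3 u² + 576 t² is 3 (u² + 192 t²). Modulo 5 the forms are 3 M² and M² + 2 e²; 3 and 2
-- are non-residues, so M and then e vanish.
¬halving-3 : ∀ {Y} → ¬ Halving Y 3
¬halving-3 H = insoluble 5 3 625 1 192 _ _ (halved-classes 3 625 1 192 refl refl H)

-- Here 5 u² + 625 t² is 5 (u² + 125 t²). Modulo 3 the second form is -M², so M vanishes; the first
-- is then -e², so e vanishes.
¬halving-5 : ∀ {Y} → ¬ Halving Y 5
¬halving-5 H = insoluble 3 1 125 5 576 _ _ (halved-classes 1 125 5 576 refl refl H)

-- The factors are 5 (3 u² + 125 t²) and 3 (5 u² + 192 t²). Modulo 3 the forms are -e² and -M².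
¬halving-15 : ∀ {Y} → ¬ Halving Y 15
¬halving-15 H = insoluble 3 3 125 5 192 _ _ (halved-classes 3 125 5 192 refl refl H)

-- For k = 1 the two forms are the concordant ones again, with e < Y in the role of Y. For k = 7 the
-- first form gives M² + e² + x² ≡ 0 modulo 4, which makes M and e even.
classes⇒smaller : ∀ {Y} → SquareClasses Y 1 625 1 576 → ∃ λ Y′ → Y′ < Y × Solution Y′
classes⇒smaller (classes {M} {e} {_} {x} {z} _ e≢0 e<Y M-odd (inj₁ refl) α≡ β≡) = e , e<Y , record
    { W = M ; X = x ; Z = z ; W-odd = M-odd ; Y≢0 = e≢0
    ; XX≡ = trans (arrange 625 M e) (trans α≡ (*-identityˡ (x * x)))
    ; ZZ≡ = trans (arrange 576 M e) (trans β≡ (*-identityˡ (z * z))) }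
  where
  arrange : ∀ a M e → M * M + a * (e * e) ≡ 1 * (M * M) + a * (e * e)
  arrange = solve-∀
classes⇒smaller (classes {M} {e} {_} {x} {z} M⊥e _ _ _ (inj₂ refl) α≡ β≡) =
  ⊥-elim (locally-insoluble 7 2 4 1 625 1 576 (divides 2 refl) _ {M} {e} {x} {z} M⊥e α≡ β≡)

halving-1⇒smaller : ∀ {Y} → Halving Y 1 → ∃ λ Y′ → Y′ < Y × Solution Y′
halving-1⇒smaller H = classes⇒smaller (halved-classes 1 625 1 576 refl refl H)

no-solution : ∀ Y → ¬ Solution Y
no-solution = <-rec (λ Y → ¬ Solution Y) λ _ rec sol →
  [ (λ H → let Y′ , Y′<Y , sol′ = halving-1⇒smaller H in rec Y′<Y sol′)
  , [ ¬halving-3 , [ ¬halving-5 , ¬halving-15 ]′ ]′ ]′ (toHalving (toQuotient sol))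

-- From two square values in a and b to a solution.

-- With a = b + 2 n, the solution is W = 25 a b, Y = (a² - b²) / 2, X = 25 (a² + b²) / 2 and Z = c
-- d, since (16 a² + 9 b²) (9 a² + 16 b²) = 144 (a² - b²)² + 625 a² b².
odd-legs : ∀ b n {c d} .{{_ : NonZero n}} → 2 ∤ b + 2 * n → 2 ∤ b →
  16 * ((b + 2 * n) * (b + 2 * n)) + 9 * (b * b) ≡ c * c →
  9 * ((b + 2 * n) * (b + 2 * n)) + 16 * (b * b) ≡ d * d → ⊥
odd-legs b n {c} {d} {{n≢0}} a-odd b-odd cc≡ dd≡ = no-solution (2 * (n * (b + n))) record
  { W = 25 * ((b + 2 * n) * b) ; X = 25 * (b * b + 2 * (b * n) + 2 * (n * n)) ; Z = c * d
  ; W-odd = odd-* (toWitnessFalse {a? = 2 ∣? 25} _) (odd-* a-odd b-odd)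
  ; Y≢0 = m*n≢0 2 (n * (b + n)) {{_}} {{m*n≢0 n (b + n) {{n≢0}} {{≢-nonZero (≢-nonZero⁻¹ n {{n≢0}} ∘ m+n≡0⇒n≡0 b)}}}}
  ; XX≡ = arrange₁ b n
  ; ZZ≡ = trans (arrange₂ b n) (trans (cong₂ _*_ cc≡ dd≡) (arrange₃ c d)) }
  where
  arrange₁ : ∀ b n → 25 * ((b + 2 * n) * b) * (25 * ((b + 2 * n) * b)) +
    625 * (2 * (n * (b + n)) * (2 * (n * (b + n)))) ≡
    25 * (b * b + 2 * (b * n) + 2 * (n * n)) * (25 * (b * b + 2 * (b * n) + 2 * (n * n)))
  arrange₁ = solve-∀
  arrange₂ : ∀ b n → 25 * ((b + 2 * n) * b) * (25 * ((b + 2 * n) * b)) +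
    576 * (2 * (n * (b + n)) * (2 * (n * (b + n)))) ≡
    (16 * ((b + 2 * n) * (b + 2 * n)) + 9 * (b * b)) * (9 * ((b + 2 * n) * (b + 2 * n)) + 16 * (b * b))
  arrange₂ = solve-∀
  arrange₃ : ∀ c d → c * c * (d * d) ≡ c * d * (c * d)
  arrange₃ = solve-∀

odd-legs-≮ : ∀ {a b c d} → 2 ∤ a → 2 ∤ b →
  16 * (a * a) + 9 * (b * b) ≡ c * c → 9 * (a * a) + 16 * (b * b) ≡ d * d → ¬ b < a
odd-legs-≮ {a} {b} {c} {d} a-odd b-odd cc≡ dd≡ b<a =
  odd-legs b n {c} {d} {{n≢0}} (subst (2 ∤_) a≡ a-odd) b-odd
    (subst (λ x → 16 * (x * x) + 9 * (b * b) ≡ c * c) a≡ cc≡)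
    (subst (λ x → 9 * (x * x) + 16 * (b * b) ≡ d * d) a≡ dd≡)
  where
  2∣a∸b : 2 ∣ a ∸ b
  2∣a∸b = odd∸odd a-odd b-odd (<⇒≤ b<a)
  n = quotient 2∣a∸b
  a≡ : a ≡ b + 2 * n
  a≡ = trans (sym (m+[n∸m]≡n (<⇒≤ b<a))) (cong (_+_ b) (m∣n⇒n≡m*quotient 2∣a∸b))
  n≢0 : NonZero n
  n≢0 = quotient≢0 2∣a∸b {{>-nonZero (m<n⇒0<n∸m b<a)}}

-- Parity and residues modulo 8 force a = 4 a₂. Then W = 3 |16 a₂² - b²|, Y = a₂ b and Z = 3 (16 a₂²
-- + b²); X² is the product of c² and d₂² = 9 a₂² + b².
even-leg : ∀ {a b c d} → NonZero a → 2 ∣ a → 2 ∤ b →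
  16 * (a * a) + 9 * (b * b) ≡ c * c → 9 * (a * a) + 16 * (b * b) ≡ d * d → ⊥
even-leg {a} {b} {c} {d} a≢0 (divides a₁ refl) b-odd cc≡ dd≡ = at-d (halve d (9 * (a₁ * a₁) + 4 * (b * b)) (trans (sym dd≡) (arrange₁ a₁ b)))
  where
  arrange₁ : ∀ a b → 9 * (a * 2 * (a * 2)) + 16 * (b * b) ≡ 4 * (9 * (a * a) + 4 * (b * b))
  arrange₁ = solve-∀
  halve : ∀ n m → n * n ≡ 4 * m → ∃ λ k → m ≡ k * k
  halve n m nn≡ = let divides k n≡ = square-∣ 2 n (subst (4 ∣_) (sym nn≡) (m∣m*n m))
    in k , *-cancelˡ-≡ m (k * k) 4 (trans (sym nn≡) (trans (cong (λ x → x * x) n≡) (arrange k)))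
    where
    arrange : ∀ k → k * 2 * (k * 2) ≡ 4 * (k * k)
    arrange = solve-∀
  b≢0 = odd⇒≢0 b-odd
  at-d : (∃ λ d₁ → 9 * (a₁ * a₁) + 4 * (b * b) ≡ d₁ * d₁) → ⊥
  at-d (d₁ , dd₁≡) with 2 ∣? a₁
  -- Odd squares are 1 modulo 8, so 9 a₁² + 4 b² is 13 modulo 8 while d₁² is 1.
  ... | no a₁-odd = toWitnessFalse {a? = 8 ∣? 12} _ 8∣12
    where
    d₁-odd : 2 ∤ d₁
    d₁-odd 2∣d₁ = odd-* (toWitnessFalse {a? = 2 ∣? 9} _) (odd-* a₁-odd a₁-odd)
      (∣m+n∣m⇒∣n (subst (2 ∣_) (trans (sym dd₁≡) (+-comm (9 * (a₁ * a₁)) (4 * (b * b)))) (∣m⇒∣m*n d₁ 2∣d₁))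
        (∣m⇒∣m*n {m = 4} (b * b) (divides 2 refl)))
    8∣12 : 8 ∣ 12
    8∣12 = let i , ai = odd-square a₁ a₁-odd
               j , bj = odd-square b b-odd
               k , dk = odd-square d₁ d₁-odd
               eq : 8 * (9 * i + 4 * j) + 12 ≡ 8 * k
               eq = suc-injective (trans (arrange i j) (trans (cong₂ (λ x y → 9 * x + 4 * y) (sym ai) (sym bj)) (trans dd₁≡ dk)))
           in ∣m+n∣m⇒∣n (subst (8 ∣_) (sym eq) (m∣m*n k)) (m∣m*n (9 * i + 4 * j))
      where
      arrange : ∀ i j → 1 + (8 * (9 * i + 4 * j) + 12) ≡ 9 * (1 + 8 * i) + 4 * (1 + 8 * j)
      arrange = solve-∀
  ... | yes (divides a₂ refl) = at-d₂ (halve d₁ (9 * (a₂ * a₂) + b * b) (trans (sym dd₁≡) (arrange₂ a₂ b)))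
    where
    arrange₂ : ∀ a b → 9 * (a * 2 * (a * 2)) + 4 * (b * b) ≡ 4 * (9 * (a * a) + b * b)
    arrange₂ = solve-∀
    a₂b≢0 : NonZero (a₂ * b)
    a₂b≢0 = m*n≢0 a₂ b {{m*n≢0⇒m≢0 a₂ {2} {{m*n≢0⇒m≢0 (a₂ * 2) {2} {{a≢0}}}}}} {{b≢0}}
    -- δ is |16 a₂² - b²|; truncated subtraction requires the two orders to be treated apart.
    difference : ∃ λ δ → 2 ∤ δ × δ * δ + 64 * (a₂ * a₂ * (b * b)) ≡
      (16 * (a₂ * a₂) + b * b) * (16 * (a₂ * a₂) + b * b)
    difference with ≤-total (b * b) (16 * (a₂ * a₂))
    ... | inj₁ bb≤ = let δ = 16 * (a₂ * a₂) ∸ b * b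
                         eq : b * b + δ ≡ 16 * (a₂ * a₂)
                         eq = m+[n∸m]≡n bb≤
                     in δ , (λ 2∣δ → odd-* b-odd b-odd (∣m+n∣m⇒∣n (subst (2 ∣_) (trans (sym eq) (+-comm (b * b) δ))
                               (∣m⇒∣m*n {m = 16} (a₂ * a₂) (divides 8 refl))) 2∣δ))
                          , identity δ (16 * (a₂ * a₂)) (b * b) (a₂ * a₂) refl (sym eq)
      where
      identity : ∀ δ x y z → x ≡ 16 * z → x ≡ y + δ → δ * δ + 64 * (z * y) ≡ (x + y) * (x + y)
      identity δ x y z x≡ refl = trans (arrange δ y z) (trans (cong (λ w → δ * δ + 4 * (w * y)) (sym x≡)) (arrange′ δ y))
        where
        arrange : ∀ δ y z → δ * δ + 64 * (z * y) ≡ δ * δ + 4 * (16 * z * y)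
        arrange = solve-∀
        arrange′ : ∀ δ y → δ * δ + 4 * ((y + δ) * y) ≡ (y + δ + y) * (y + δ + y)
        arrange′ = solve-∀
    ... | inj₂ ≤bb = let δ = b * b ∸ 16 * (a₂ * a₂)
                         eq : 16 * (a₂ * a₂) + δ ≡ b * b
                         eq = m+[n∸m]≡n ≤bb
                     in δ , (λ 2∣δ → odd-* b-odd b-odd (subst (2 ∣_) eq
                               (∣m∣n⇒∣m+n (∣m⇒∣m*n {m = 16} (a₂ * a₂) (divides 8 refl)) 2∣δ)))
                          , identity δ (b * b) (a₂ * a₂) (sym eq)
      where
      identity : ∀ δ y z → y ≡ 16 * z + δ → δ * δ + 64 * (z * y) ≡ (16 * z + y) * (16 * z + y)
      identity δ y z refl = arrange δ z
        where
        arrange : ∀ δ z → δ * δ + 64 * (z * (16 * z + δ)) ≡ (16 * z + (16 * z + δ)) * (16 * z + (16 * z + δ))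
        arrange = solve-∀
    at-d₂ : (∃ λ d₂ → 9 * (a₂ * a₂) + b * b ≡ d₂ * d₂) → ⊥
    at-d₂ (d₂ , dd₂≡) = let δ , δ-odd , δδ≡ = difference in no-solution (a₂ * b) record
      { W = 3 * δ ; X = c * d₂ ; Z = 3 * (16 * (a₂ * a₂) + b * b)
      ; W-odd = odd-* (toWitnessFalse {a? = 2 ∣? 3} _) δ-odd
      ; Y≢0 = a₂b≢0
      ; XX≡ = trans (arrangeX δ a₂ b) (trans (cong (λ x → 9 * x + 49 * (a₂ * a₂ * (b * b))) δδ≡)
                (trans (arrangeX′ a₂ b) (trans (cong₂ _*_ cc≡ dd₂≡) (arrange₃ c d₂))))
      ; ZZ≡ = trans (arrangeZ δ a₂ b) (trans (cong (9 *_) δδ≡) (arrangeZ′ (16 * (a₂ * a₂) + b * b))) }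
      where
      arrangeX : ∀ δ a b → 3 * δ * (3 * δ) + 625 * (a * b * (a * b)) ≡
        9 * (δ * δ + 64 * (a * a * (b * b))) + 49 * (a * a * (b * b))
      arrangeX = solve-∀
      arrangeX′ : ∀ a b → 9 * ((16 * (a * a) + b * b) * (16 * (a * a) + b * b)) + 49 * (a * a * (b * b)) ≡
        (16 * (a * 2 * 2 * (a * 2 * 2)) + 9 * (b * b)) * (9 * (a * a) + b * b)
      arrangeX′ = solve-∀
      arrange₃ : ∀ c d → c * c * (d * d) ≡ c * d * (c * d)
      arrange₃ = solve-∀
      arrangeZ : ∀ δ a b → 3 * δ * (3 * δ) + 576 * (a * b * (a * b)) ≡ 9 * (δ * δ + 64 * (a * a * (b * b)))
      arrangeZ = solve-∀
      arrangeZ′ : ∀ s → 9 * (s * s) ≡ 3 * s * (3 * s)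
      arrangeZ′ = solve-∀

-- Exchanging a with b and c with d preserves the hypotheses, so one argument covers either even
-- leg, and for odd legs both strict orders.
legs-equal : ∀ {a b c d} → NonZero a → NonZero b → Coprime a b →
  16 * (a * a) + 9 * (b * b) ≡ c * c → 9 * (a * a) + 16 * (b * b) ≡ d * d → a ≡ b
legs-equal {a} {b} {c} {d} a≢0 b≢0 a⊥b cc≡ dd≡ = split (2 ∣? a) (2 ∣? b)
  where
  cc≡′ : 9 * (b * b) + 16 * (a * a) ≡ c * c
  cc≡′ = trans (+-comm (9 * (b * b)) (16 * (a * a))) cc≡
  dd≡′ : 16 * (b * b) + 9 * (a * a) ≡ d * d
  dd≡′ = trans (+-comm (16 * (b * b)) (9 * (a * a))) dd≡
  split : Dec (2 ∣ a) → Dec (2 ∣ b) → a ≡ b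
  split (yes 2∣a) (yes 2∣b) = contradiction (a⊥b (2∣a , 2∣b)) λ ()
  split (yes 2∣a) (no b-odd) = ⊥-elim (even-leg {c = c} {d} a≢0 2∣a b-odd cc≡ dd≡)
  split (no a-odd) (yes 2∣b) = ⊥-elim (even-leg {c = d} {c} b≢0 2∣b a-odd dd≡′ cc≡′)
  split (no a-odd) (no b-odd) = ≤-antisym
    (≮⇒≥ (odd-legs-≮ {c = c} {d} a-odd b-odd cc≡ dd≡)) (≮⇒≥ (odd-legs-≮ {c = d} {c} b-odd a-odd dd≡′ cc≡′))

-- From rational squares to squares of natural numbers.

fromℕ : ℕ → ℚ
fromℕ n = + n ℚ./ 1

toℚᵘ-fromℕ : ∀ n → toℚᵘ (fromℕ n) ℚᵘ.≃ mkℚᵘ (+ n) 0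
toℚᵘ-fromℕ n = ℚ.toℚᵘ-fromℚᵘ (mkℚᵘ (+ n) 0)

fromℕ-+ : ∀ m n → fromℕ (m + n) ≡ fromℕ m ℚ.+ fromℕ n
fromℕ-+ m n = ℚ.toℚᵘ-injective (begin
  toℚᵘ (fromℕ (m + n))                 ≈⟨ toℚᵘ-fromℕ (m + n) ⟩
  mkℚᵘ (+ (m + n)) 0                   ≈⟨ *≡* (cong (ℤ._* + 1) (cong₂ ℤ._+_ (sym (ℤ.*-identityʳ (+ m))) (sym (ℤ.*-identityʳ (+ n))))) ⟩
  mkℚᵘ (+ m) 0 ℚᵘ.+ mkℚᵘ (+ n) 0       ≈⟨ ℚᵘ.+-cong (toℚᵘ-fromℕ m) (toℚᵘ-fromℕ n) ⟨
  toℚᵘ (fromℕ m) ℚᵘ.+ toℚᵘ (fromℕ n)   ≈⟨ ℚ.toℚᵘ-homo-+ (fromℕ m) (fromℕ n) ⟨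
  toℚᵘ (fromℕ m ℚ.+ fromℕ n)           ∎)
  where open ℚᵘ.≃-Reasoning

fromℕ-* : ∀ m n → fromℕ (m * n) ≡ fromℕ m ℚ.* fromℕ n
fromℕ-* m n = ℚ.toℚᵘ-injective (begin
  toℚᵘ (fromℕ (m * n))                 ≈⟨ toℚᵘ-fromℕ (m * n) ⟩
  mkℚᵘ (+ (m * n)) 0                   ≈⟨ *≡* (cong (ℤ._* + 1) (ℤ.pos-* m n)) ⟩
  mkℚᵘ (+ m) 0 ℚᵘ.* mkℚᵘ (+ n) 0       ≈⟨ ℚᵘ.*-cong (toℚᵘ-fromℕ m) (toℚᵘ-fromℕ n) ⟨
  toℚᵘ (fromℕ m) ℚᵘ.* toℚᵘ (fromℕ n)   ≈⟨ ℚ.toℚᵘ-homo-* (fromℕ m) (fromℕ n) ⟨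
  toℚᵘ (fromℕ m ℚ.* fromℕ n)           ∎)
  where open ℚᵘ.≃-Reasoning

rational-sqrt-fraction : ∀ q n → q ℚ.* q ≡ fromℕ n →
  ∃₂ λ i j → NonZero j × i * i ≡ n * (j * j)
rational-sqrt-fraction q@(mkℚ m d-1 _) n qq≡ = ℤ.∣ m ∣ , suc d-1 , _ , cross q≃
  where
  q≃ : mkℚᵘ m d-1 ℚᵘ.* mkℚᵘ m d-1 ℚᵘ.≃ mkℚᵘ (+ n) 0
  q≃ = begin
    toℚᵘ q ℚᵘ.* toℚᵘ q ≈⟨ ℚ.toℚᵘ-homo-* q q ⟨
    toℚᵘ (q ℚ.* q)     ≈⟨ ℚ.toℚᵘ-cong qq≡ ⟩
    toℚᵘ (fromℕ n)     ≈⟨ toℚᵘ-fromℕ n ⟩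
    mkℚᵘ (+ n) 0       ∎
    where open ℚᵘ.≃-Reasoning
  cross : mkℚᵘ m d-1 ℚᵘ.* mkℚᵘ m d-1 ℚᵘ.≃ mkℚᵘ (+ n) 0 → ℤ.∣ m ∣ * ℤ.∣ m ∣ ≡ n * (suc d-1 * suc d-1)
  cross (*≡* eq) = begin
    ℤ.∣ m ∣ * ℤ.∣ m ∣              ≡⟨ ℤ.abs-* m m ⟨
    ℤ.∣ m ℤ.* m ∣                ≡⟨ cong ℤ.∣_∣ (ℤ.*-identityʳ (m ℤ.* m)) ⟨
    ℤ.∣ m ℤ.* m ℤ.* + 1 ∣        ≡⟨ cong ℤ.∣_∣ eq ⟩
    ℤ.∣ + n ℤ.* + (suc d-1 * suc d-1) ∣ ≡⟨ ℤ.abs-* (+ n) (+ (suc d-1 * suc d-1)) ⟩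
    n * (suc d-1 * suc d-1)    ∎
    where open ≡-Reasoning

-- For q = ± i / j the hypothesis is i² = (s j)² n, so s j ∣ i by `square-∣` and c is i / (s j).
rational-square⇒square : ∀ q s n .{{_ : NonZero s}} → q ℚ.* q ≡ fromℕ (s * s * n) → ∃ λ c → n ≡ c * c
rational-square⇒square q s n {{s≢0}} qq≡ = at (rational-sqrt-fraction q (s * s * n) qq≡)
  where
  at : (∃₂ λ i j → NonZero j × i * i ≡ s * s * n * (j * j)) → ∃ λ c → n ≡ c * c
  at (i , j , j≢0 , ii≡) = c , *-cancelˡ-≡ n (c * c) (s * j * (s * j)) {{m*n≢0 (s * j) (s * j)}}
      (trans (sym ii≡′) (trans (cong (λ x → x * x) i≡) (arrange₂ c (s * j))))
    where
    instance
      sj≢0 : NonZero (s * j)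
      sj≢0 = m*n≢0 s j {{s≢0}} {{j≢0}}
    arrange₁ : ∀ s j n → s * s * n * (j * j) ≡ s * j * (s * j) * n
    arrange₁ = solve-∀
    arrange₂ : ∀ c k → c * k * (c * k) ≡ k * k * (c * c)
    arrange₂ = solve-∀
    ii≡′ : i * i ≡ s * j * (s * j) * n
    ii≡′ = trans ii≡ (arrange₁ s j n)
    sj∣i = square-∣ (s * j) i (subst (s * j * (s * j) ∣_) (sym ii≡′) (m∣m*n n))
    c = quotient sj∣i
    i≡ : i ≡ c * (s * j)
    i≡ = m∣n⇒n≡quotient*m sj∣i

-- Writing the denominator as a + b makes b the numerator of 1 - t, and 0 < t < 1 becomes the
-- nonvanishing of a and b.
record UnitFraction (t : ℚ) : Set where
  field
    a b : ℕ
    a≢0 : NonZero a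
    b≢0 : NonZero b
    a⊥b : Coprime a b
    t≡  : t ℚ.* fromℕ (a + b) ≡ fromℕ a

unitFraction : ∀ t → 0ℚ ℚ.< t → t ℚ.< 1ℚ → UnitFraction t
unitFraction (mkℚ (+ zero)  d-1 _)   (ℚ.*<* (ℤ.+<+ ()))
unitFraction (mkℚ -[1+ _ ]  d-1 _)   (ℚ.*<* ())
unitFraction t@(mkℚ (+ suc n) d-1 n⊥d) _ (ℚ.*<* n<d) = record
  { a = suc n ; b = b ; a≢0 = _ ; b≢0 = >-nonZero (m<n⇒0<n∸m a<d)
  ; a⊥b = λ { {e} (e∣a , e∣b) → a⊥d (e∣a , subst (e ∣_) a+b≡ (∣m∣n⇒∣m+n e∣a e∣b)) }
  ; t≡ = subst (λ x → t ℚ.* fromℕ x ≡ fromℕ (suc n)) (sym a+b≡) t≡ }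
  where
  a<d : suc n < suc d-1
  a<d = ℤ.drop‿+<+ (subst₂ ℤ._<_ (ℤ.*-identityʳ (+ suc n)) (ℤ.*-identityˡ (+ suc d-1)) n<d)
  b = suc d-1 ∸ suc n
  a+b≡ : suc n + b ≡ suc d-1
  a+b≡ = m+[n∸m]≡n (<⇒≤ a<d)
  -- The coprimality proof inside `mkℚ` is irrelevant, so a usable one is recomputed by decision.
  a⊥d : Coprime (suc n) (suc d-1)
  a⊥d = recompute (coprime? (suc n) (suc d-1)) n⊥d
  t≡ : t ℚ.* fromℕ (suc d-1) ≡ fromℕ (suc n)
  t≡ = ℚ.toℚᵘ-injective (begin
    toℚᵘ (t ℚ.* fromℕ (suc d-1))            ≈⟨ ℚ.toℚᵘ-homo-* t (fromℕ (suc d-1)) ⟩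
    toℚᵘ t ℚᵘ.* toℚᵘ (fromℕ (suc d-1))      ≈⟨ ℚᵘ.*-congˡ {toℚᵘ t} (toℚᵘ-fromℕ (suc d-1)) ⟩
    mkℚᵘ (+ suc n) d-1 ℚᵘ.* mkℚᵘ (+ suc d-1) 0 ≈⟨ *≡* (trans (ℤ.*-identityʳ (+ suc n ℤ.* + suc d-1)) (cong (λ x → + suc n ℤ.* + x) (sym (*-identityʳ (suc d-1))))) ⟩
    mkℚᵘ (+ suc n) 0                        ≈⟨ toℚᵘ-fromℕ (suc n) ⟨
    toℚᵘ (fromℕ (suc n))                    ∎)
    where open ℚᵘ.≃-Reasoning

fromℕ-form : ∀ s k l a b → fromℕ (s * s * (k * (a * a) + l * (b * b))) ≡
  fromℕ s ℚ.* fromℕ s ℚ.* (fromℕ k ℚ.* (fromℕ a ℚ.* fromℕ a) ℚ.+ fromℕ l ℚ.* (fromℕ b ℚ.* fromℕ b))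
fromℕ-form s k l a b = begin
  fromℕ (s * s * (k * (a * a) + l * (b * b)))
    ≡⟨ fromℕ-* (s * s) (k * (a * a) + l * (b * b)) ⟩
  fromℕ (s * s) ℚ.* fromℕ (k * (a * a) + l * (b * b))
    ≡⟨ cong₂ ℚ._*_ (fromℕ-* s s) (fromℕ-+ (k * (a * a)) (l * (b * b))) ⟩
  fromℕ s ℚ.* fromℕ s ℚ.* (fromℕ (k * (a * a)) ℚ.+ fromℕ (l * (b * b)))
    ≡⟨ cong (fromℕ s ℚ.* fromℕ s ℚ.*_) (cong₂ ℚ._+_ (scaled-square k a) (scaled-square l b)) ⟩
  fromℕ s ℚ.* fromℕ s ℚ.* (fromℕ k ℚ.* (fromℕ a ℚ.* fromℕ a) ℚ.+ fromℕ l ℚ.* (fromℕ b ℚ.* fromℕ b)) ∎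
  where
  open ≡-Reasoning
  scaled-square : ∀ k a → fromℕ (k * (a * a)) ≡ fromℕ k ℚ.* (fromℕ a ℚ.* fromℕ a)
  scaled-square k a = trans (fromℕ-* k (a * a)) (cong (fromℕ k ℚ.*_) (fromℕ-* a a))

-- Distances along the segment.

-- Definitionally the point of parameter t in `OpenSegment U V`.
segmentPoint : ℚ → RationalPoint
segmentPoint t = (1ℚ ℚ.- t) ℚ.* proj₁ U ℚ.+ t ℚ.* proj₁ V , (1ℚ ℚ.- t) ℚ.* proj₂ U ℚ.+ t ℚ.* proj₂ V

open +-*-Solver

-- Scaling by D = a + b clears the denominator of t: D² times the squared distance is (50 a - p D)²
-- + (q D)², and the assumed identity writes this as 10² times the form in a and b.
distance⇒square : ∀ {t} (F : UnitFraction t) (Q : RationalPoint) k l → let p , q = Q in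
  (∀ α β → (fromℕ 50 ℚ.* α ℚ.- p ℚ.* (α ℚ.+ β)) ℚ.* (fromℕ 50 ℚ.* α ℚ.- p ℚ.* (α ℚ.+ β)) ℚ.+
           q ℚ.* (α ℚ.+ β) ℚ.* (q ℚ.* (α ℚ.+ β)) ≡
           fromℕ 10 ℚ.* fromℕ 10 ℚ.* (fromℕ k ℚ.* (α ℚ.* α) ℚ.+ fromℕ l ℚ.* (β ℚ.* β))) →
  RationalDistance (segmentPoint t) Q →
  let open UnitFraction F in ∃ λ c → k * (a * a) + l * (b * b) ≡ c * c
distance⇒square {t} F (p , q) k l form≡ (r , _ , rr≡) =
  rational-square⇒square (D ℚ.* r) 10 (k * (a * a) + l * (b * b)) (begin
    D ℚ.* r ℚ.* (D ℚ.* r)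
      ≡⟨ solve 2 (λ D r → D :* r :* (D :* r) := D :* D :* (r :* r)) refl D r ⟩
    D ℚ.* D ℚ.* (r ℚ.* r)
      ≡⟨ cong (D ℚ.* D ℚ.*_) rr≡ ⟩
    D ℚ.* D ℚ.* ((x ℚ.- p) ℚ.* (x ℚ.- p) ℚ.+ (y ℚ.- q) ℚ.* (y ℚ.- q))
      ≡⟨ solve 4 (λ t D p q →
           let x = (con 1ℚ :- t) :* con (fromℕ 0) :+ t :* con (fromℕ 50)
               y = (con 1ℚ :- t) :* con (fromℕ 0) :+ t :* con (fromℕ 0)
               z = con (fromℕ 50) :* (t :* D) :- p :* D
           in D :* D :* ((x :- p) :* (x :- p) :+ (y :- q) :* (y :- q)) := z :* z :+ q :* D :* (q :* D))
         refl t D p q ⟩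
    (fromℕ 50 ℚ.* (t ℚ.* D) ℚ.- p ℚ.* D) ℚ.* (fromℕ 50 ℚ.* (t ℚ.* D) ℚ.- p ℚ.* D) ℚ.+ q ℚ.* D ℚ.* (q ℚ.* D)
      ≡⟨ cong₂ (λ α D → (fromℕ 50 ℚ.* α ℚ.- p ℚ.* D) ℚ.* (fromℕ 50 ℚ.* α ℚ.- p ℚ.* D) ℚ.+ q ℚ.* D ℚ.* (q ℚ.* D))
           t≡ (fromℕ-+ a b) ⟩
    _ ≡⟨ form≡ (fromℕ a) (fromℕ b) ⟩
    _ ≡⟨ fromℕ-form 10 k l a b ⟨
    fromℕ (10 * 10 * (k * (a * a) + l * (b * b))) ∎)
  where
  open UnitFraction F
  open ≡-Reasoning
  D = fromℕ (a + b)
  x = proj₁ (segmentPoint t)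
  y = proj₂ (segmentPoint t)

-- U, A, V is a right triangle with legs UA = 30 and VA = 40. The mixed term vanishes, and (a + b)²
-- PA² = (40 a)² + (30 b)².
squareA : ∀ {t} (F : UnitFraction t) → RationalDistance (segmentPoint t) A →
  let open UnitFraction F in ∃ λ c → 16 * (a * a) + 9 * (b * b) ≡ c * c
squareA F = distance⇒square F A 16 9 (solve 2 (λ α β →
  let z = con (fromℕ 50) :* α :- con (proj₁ A) :* (α :+ β)
      w = con (proj₂ A) :* (α :+ β)
  in z :* z :+ w :* w := con (fromℕ 10) :* con (fromℕ 10) :*
       (con (fromℕ 16) :* (α :* α) :+ con (fromℕ 9) :* (β :* β))) refl)

-- The right angle is now at B, with UB = 40 and VB = 30, so the coefficients are exchanged.
squareB : ∀ {t} (F : UnitFraction t) → RationalDistance (segmentPoint t) B →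
  let open UnitFraction F in ∃ λ d → 9 * (a * a) + 16 * (b * b) ≡ d * d
squareB F = distance⇒square F B 9 16 (solve 2 (λ α β →
  let z = con (fromℕ 50) :* α :- con (proj₁ B) :* (α :+ β)
      w = con (proj₂ B) :* (α :+ β)
  in z :* z :+ w :* w := con (fromℕ 10) :* con (fromℕ 10) :*
       (con (fromℕ 9) :* (α :* α) :+ con (fromℕ 16) :* (β :* β))) refl)

parameter≡½ : ∀ {t} → 0ℚ ℚ.< t → t ℚ.< 1ℚ → RationalDistance (segmentPoint t) A →
  RationalDistance (segmentPoint t) B → t ≡ ½
parameter≡½ {t} 0<t t<1 PA PB = t≡½ a≡b (a⊥b (∣-refl , subst (a ∣_) a≡b ∣-refl)) t≡
  where
  F = unitFraction t 0<t t<1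
  open UnitFraction F
  a≡b : a ≡ b
  a≡b = let c , cc≡ = squareA F PA
            d , dd≡ = squareB F PB
        in legs-equal {a} {b} {c} {d} a≢0 b≢0 a⊥b cc≡ dd≡
  t≡½ : ∀ {a b} → a ≡ b → a ≡ 1 → t ℚ.* fromℕ (a + b) ≡ fromℕ a → t ≡ ½
  t≡½ refl refl t*2≡1 = trans (solve 1 (λ t → t := t :* con (fromℕ 2) :* con ½) refl t) (cong (ℚ._* ½) t*2≡1)

theorem6p8 : (λ P → OpenSegment U V P × RationalDistance P U × RationalDistance P V × RationalDistance P A × RationalDistance P B)
    ≐ ｛ midpointUV ｝
theorem6p8 = only-midpoint , midpoint-works
  where
  only-midpoint : ∀ {P} → OpenSegment U V P × RationalDistance P U × RationalDistance P V ×
    RationalDistance P A × RationalDistance P B → midpointUV ≡ P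
  only-midpoint ((t , 0<t , t<1 , refl) , _ , _ , PA , PB) =
    sym (cong segmentPoint (parameter≡½ 0<t t<1 PA PB))
  0≤ : ∀ n → 0ℚ ℚ.≤ fromℕ n
  0≤ n = ℚ.nonNegative⁻¹ (fromℕ n) {{ℚ.normalize-nonNeg n 1}}
  midpoint-works : ∀ {P} → midpointUV ≡ P → OpenSegment U V P × RationalDistance P U ×
    RationalDistance P V × RationalDistance P A × RationalDistance P B
  midpoint-works refl = (½ , toWitness {a? = 0ℚ ℚ.<? ½} _ , toWitness {a? = ½ ℚ.<? 1ℚ} _ , refl) ,
    -- The midpoint is the centre of the rectangle U A V B, whose diagonals have length 50.
    (fromℕ 25 , 0≤ 25 , refl) , (fromℕ 25 , 0≤ 25 , refl) , (fromℕ 25 , 0≤ 25 , refl) , (fromℕ 25 , 0≤ 25 , refl)
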